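{- Let $k \ge 3$ and let $G$ be a connected $k$-regular graph of order $n$ with $G \not\cong K_{k,k}$. If $G$ is not bipartite, then $\gamma_{\rm gr}^t(G) \ge \dfrac{n + \lceil k/2 \rceil - 2}{k-1}$; if $G$ is bipartite, then $\gamma_{\rm gr}^t(G) \ge \dfrac{n + 2\lceil k/2 \rceil - 4}{k-1}$.
   Context: $N(v)$ denotes the open neighborhood of $v$. A sequence $S=(v_1,\ldots,v_k)$ of distinct vertices of a graph $G$ without isolated vertices is a legal sequence if $N(v_i)\setminus \bigcup_{j=1}^{i-1} N(v_j)\neq\emptyset$ for every $i\in\{2,\ldots,k\}$, and a total dominating sequence if moreover $\{v_1,\ldots,v_k\}$ is a total dominating set of $G$. $\gamma_{\rm gr}^t(G)$ is the maximum length of a total dominating sequence of $G$. -}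

module Defs where

open import Data.Bool.Base using (Bool; true; false)
open import Data.Bool.Properties using () renaming (_≟_ to _≟ᵇ_)
open import Data.Fin.Base using (Fin; zero; suc; toℕ; splitAt)
open import Data.Fin.Properties using (all?; any?; injective⇒≤) renaming (_≟_ to _≟ᶠ_)
open import Data.Fin.Subset using (Subset; ⋃; _─_; ∁; ∣_∣; Nonempty) renaming (_∈_ to _∈ˢ_)
open import Data.Fin.Subset.Properties using (nonempty?)
open import Data.List.Base
  using (List; []; _∷_; length; lookup; map; take; filter; allFin; upTo; concatMap; cartesianProductWith)
open import Data.List.Extrema.Nat using (max; argmax-sel; xs≤max)
open import Data.List.Membership.DecPropositional using () renaming (_∈?_ to member?)
open import Data.List.Membership.Propositional using (_∈_; lose)
open import Data.List.Membership.Propositional.Properties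
  using (∈-map⁺; ∈-map⁻; ∈-filter⁺; ∈-filter⁻; ∈-concatMap⁺; ∈-cartesianProductWith⁺; ∈-allFin; ∈-upTo⁺; ∈-lookup)
open import Data.List.Relation.Unary.All using () renaming (lookup to All-lookup)
open import Data.List.Relation.Unary.AllPairs using (_∷_)
open import Data.List.Relation.Unary.Any using (here)
open import Data.List.Relation.Unary.Unique.DecPropositional using () renaming (unique? to uniqueDec)
open import Data.List.Relation.Unary.Unique.Propositional using (Unique)
open import Data.Nat.Base using (ℕ; zero; suc; _+_; _∸_; _≤_; _<_; NonZero; s≤s)
open import Data.Nat.Properties using (_<?_; n≤0⇒n≡0)
open import Data.Product.Base using (∃; _×_; _,_; proj₁; proj₂)
open import Data.Sum.Base using (inj₁; inj₂; [_,_]′)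
open import Data.Vec.Base using (tabulate)
open import Function.Base using (const)
open import Function.Bundles using (_↔_; _⇔_; Inverse)
open import Level using (0ℓ)
open import Relation.Binary.Construct.Closure.ReflexiveTransitive using (Star)
open import Relation.Binary.Core using (Rel)
open import Relation.Binary.Definitions using (Decidable; Symmetric; Irreflexive)
open import Relation.Binary.PropositionalEquality using (_≡_; _≢_; refl; cong; ≢-sym) renaming (sym to ≡-sym; subst to ≡-subst)
open import Relation.Nullary using (¬_; Dec; does; contradiction)
open import Relation.Nullary.Decidable using (_×-dec_; _→-dec_; ¬?; map′)
open import Relation.Unary using (Pred)

record Graph (n : ℕ) : Set₁ where
  infix 4 _~_ _~?_
  field
    _~_    : Rel (Fin n) 0ℓ
    _~?_   : Decidable _~_
    sym    : Symmetric _~_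
    irrefl : Irreflexive _≡_ _~_

record _≅_ {m n : ℕ} (G : Graph m) (H : Graph n) : Set where
  private
    module G = Graph G
    module H = Graph H
  field
    vertices : Fin m ↔ Fin n
    adjacent : ∀ u v → (u G.~ v) ⇔ (Inverse.to vertices u H.~ Inverse.to vertices v)

completeBipartite : (m n : ℕ) → Graph (m + n)
completeBipartite m n = record
  { _~_    = λ u v → side u ≢ side v
  ; _~?_   = λ u v → ¬? (side u ≟ᵇ side v)
  ; sym    = ≢-sym
  ; irrefl = λ { refl ≢ → ≢ refl }
  }
  where
  side : Fin (m + n) → Bool
  side u = [ const false , const true ]′ (splitAt m u)

module _ {n : ℕ} (G : Graph n) where
  open Graph G

  N : Fin n → Subset n
  N v = tabulate (λ w → does (v ~? w))

  degree : Fin n → ℕ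
  degree v = ∣ N v ∣

  IsRegular : ℕ → Set
  IsRegular k = ∀ v → degree v ≡ k

  -- The null graph (n = 0) is not connected.
  IsConnected : Set
  IsConnected = NonZero n × (∀ u v → Star _~_ u v)

  IsIndependent : Subset n → Set
  IsIndependent A = ∀ u v → u ∈ˢ A → v ∈ˢ A → ¬ (u ~ v)

  IsBipartite : Set
  IsBipartite = ∃ λ (A : Subset n) → IsIndependent A × IsIndependent (∁ A)

  IsTotalDominatingSet : Pred (Fin n) 0ℓ → Set
  IsTotalDominatingSet D = ∀ v → ∃ λ u → D u × v ~ u

  -- Positions are counted from 0, so `0 < toℕ i` excludes the first vertex.
  record IsLegal (S : List (Fin n)) : Set where
    constructor legal
    field
      distinct   : Unique S
      footprints : ∀ (i : Fin (length S)) → 0 < toℕ i →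
                   Nonempty (N (lookup S i) ─ ⋃ (map N (take (toℕ i) S)))

  IsTotalDominatingSequence : List (Fin n) → Set
  IsTotalDominatingSequence S = IsLegal S × IsTotalDominatingSet (_∈ S)

  isLegal? : (S : List (Fin n)) → Dec (IsLegal S)
  isLegal? S = map′ (λ (d , f) → legal d f) (λ (legal d f) → d , f)
    (uniqueDec _≟ᶠ_ S ×-dec
     all? (λ i → (0 <? toℕ i) →-dec
                 nonempty? (N (lookup S i) ─ ⋃ (map N (take (toℕ i) S)))))

  isTotalDominatingSequence? : (S : List (Fin n)) → Dec (IsTotalDominatingSequence S)
  isTotalDominatingSequence? S =
    isLegal? S ×-dec all? (λ v → any? (λ u → member? _≟ᶠ_ u S ×-dec (v ~? u)))

sequencesOfLength : (n m : ℕ) → List (List (Fin n))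
sequencesOfLength n zero    = [] ∷ []
sequencesOfLength n (suc m) = cartesianProductWith _∷_ (allFin n) (sequencesOfLength n m)

-- A sequence of distinct vertices has length at most n, so only lengths 0, …, n
-- need to be searched.
sequences : (n : ℕ) → List (List (Fin n))
sequences n = concatMap (sequencesOfLength n) (upTo (suc n))

totalDominatingSequences : ∀ {n} → Graph n → List (List (Fin n))
totalDominatingSequences {n} G = filter (isTotalDominatingSequence? G) (sequences n)

-- The maximum length of a total dominating sequence; it is 0 by convention if
-- there is none, that is, if G has an isolated vertex.  See γᵗgr-upper and
-- γᵗgr-attained.
γᵗgr : ∀ {n} → Graph n → ℕ
γᵗgr G = max 0 (map length (totalDominatingSequences G))

private
  ∈-sequencesOfLength : ∀ {n} (S : List (Fin n)) → S ∈ sequencesOfLength n (length S)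
  ∈-sequencesOfLength []      = here refl
  ∈-sequencesOfLength (v ∷ S) =
    ∈-cartesianProductWith⁺ _∷_ (∈-allFin v) (∈-sequencesOfLength S)

  lookup-injective : ∀ {n} {S : List (Fin n)} → Unique S →
                     ∀ {i j} → lookup S i ≡ lookup S j → i ≡ j
  lookup-injective (_ ∷ _) {zero}  {zero}  _  = refl
  lookup-injective (v∉ ∷ _) {zero}  {suc j} eq = contradiction eq (All-lookup v∉ (∈-lookup j))
  lookup-injective (v∉ ∷ _) {suc i} {zero}  eq = contradiction (≡-sym eq) (All-lookup v∉ (∈-lookup i))
  lookup-injective (_ ∷ u) {suc i} {suc j} eq = cong suc (lookup-injective u eq)

∈-totalDominatingSequences : ∀ {n} (G : Graph n) {S : List (Fin n)} →
  IsTotalDominatingSequence G S → S ∈ totalDominatingSequences G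
∈-totalDominatingSequences {n} G {S} tds@(legal distinct _ , _) =
  ∈-filter⁺ (isTotalDominatingSequence? G)
    (∈-concatMap⁺ (sequencesOfLength n)
      (lose (∈-upTo⁺ (s≤s (injective⇒≤ (lookup-injective distinct))))
            (∈-sequencesOfLength S)))
    tds

γᵗgr-upper : ∀ {n} (G : Graph n) {S : List (Fin n)} →
  IsTotalDominatingSequence G S → length S ≤ γᵗgr G
γᵗgr-upper G tds =
  All-lookup (xs≤max 0 _) (∈-map⁺ length (∈-totalDominatingSequences G tds))

γᵗgr-attained : ∀ {n} (G : Graph n) → ∃ (IsTotalDominatingSequence G) →
  ∃ λ S → IsTotalDominatingSequence G S × length S ≡ γᵗgr G
γᵗgr-attained {n} G (S , tds)
  with argmax-sel (λ m → m) 0 (map length (totalDominatingSequences G))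
... | inj₁ eq = S , tds ,
  ≡-subst (length S ≡_) (≡-sym eq) (n≤0⇒n≡0 (≡-subst (length S ≤_) eq (γᵗgr-upper G tds)))
... | inj₂ γ∈ with ∈-map⁻ length γ∈
...   | T , T∈ , eq =
  T , proj₂ (∈-filter⁻ (isTotalDominatingSequence? G) {xs = sequences n} T∈) , ≡-sym eq

3≤k⇒k∸1≢0 : ∀ {k} → 3 ≤ k → NonZero (k ∸ 1)
3≤k⇒k∸1≢0 (s≤s (s≤s _)) = _

{-# OPTIONS --safe #-}

-- Build the sequence greedily, on each component of the hypergraph of open
-- neighbourhoods (one component if G is not bipartite, one per class if it is).
-- By connectedness some neighbourhood always meets both the set U of uncovered
-- vertices and its complement, so each step after the first covers at most k - 1
-- new vertices.  A further s = ⌈k/2⌉ - 1 is gained as follows.  If two distinct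
-- neighbourhoods share more than s vertices, start with these two.  Otherwise
-- postpone the last step as long as possible; then the final U lies in two distinct
-- neighbourhoods, so it has at most s vertices, and 2s ≤ k - 1.
-- Everything is written in terms of d = k - 1, for which s = ⌊d/2⌋.

module Submission where

open import Defs
open import Data.Bool.Base using (true; false; not)
open import Data.Bool.Properties using (not-injective)
open import Data.Empty using (⊥-elim)
open import Data.Fin.Base using (Fin; zero; suc; toℕ; splitAt; join)
open import Data.Fin.Properties using (any?; +↔⊎; splitAt-join)
open import Data.Fin.Subset
  using (Subset; ⊤; ⋃; _∩_; _∪_; _─_; ∁; ∣_∣; Nonempty; Empty; _∈_; _∉_; _⊆_; _⊂_)
open import Data.Fin.Subset.Induction using (⊂-wellFounded)
open import Data.Fin.Subset.Properties
import Data.Integer.Base as ℤ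
import Data.Integer.Properties as ℤ
open import Data.List.Base using (List; []; _∷_; _++_; length; lookup; map; take)
import Data.List.Membership.Propositional as List
open import Data.List.Membership.Propositional.Properties using (∈-map⁺)
open import Data.List.Properties using (length-map; length-++)
open import Data.List.Relation.Unary.All as All using (All; []; _∷_)
import Data.List.Relation.Unary.All.Properties as All
open import Data.List.Relation.Unary.AllPairs as AllPairs using (AllPairs; []; _∷_)
import Data.List.Relation.Unary.AllPairs.Properties as AllPairs
open import Data.List.Relation.Unary.Any as Any using (Any; here; there)
import Data.List.Relation.Unary.Any.Properties as Any
open import Data.Nat.Base as Nat using (ℕ; zero; suc; _∸_; _≤_; _<_; ⌊_/2⌋; ⌈_/2⌉; z≤n; s≤s)
open import Data.Nat.Properties
open import Data.Nat.Solver using (module +-*-Solver)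
open import Data.Product.Base using (∃; _×_; _,_; proj₁; proj₂)
import Data.Rational.Properties as ℚ
import Data.Rational.Unnormalised.Base as ℚᵘ
import Data.Rational.Unnormalised.Properties as ℚᵘ
open import Data.Sum.Base using (_⊎_; inj₁; inj₂; [_,_]′; map₁; map₂)
open import Data.Vec.Base as Vec using ([]; _∷_)
open import Data.Vec.Properties using (lookup∘tabulate; []=⇒lookup; lookup⇒[]=)
open import Function.Base using (_∘_; const; id)
open import Function.Bundles using (_↔_; _⇔_; mk⇔; mk↔ₛ′; Equivalence)
open import Function.Construct.Composition using (_↔-∘_)
open import Function.Construct.Symmetry using (↔-sym)
open import Induction.WellFounded using (Acc; acc)
open import Relation.Binary.Construct.Closure.ReflexiveTransitive using (Star; ε; _◅_)
open import Relation.Binary.PropositionalEquality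
open import Relation.Nullary using (¬_; Dec; yes; no; does; contradiction)
open import Relation.Nullary.Decidable using (_×-dec_; ¬?; dec-true; decidable-stable)

-- Cardinalities of finite subsets.

module _ where
  open Nat using (_+_)

  x∈p─q⇒x∉q : ∀ {n} (p q : Subset n) {x} → x ∈ p ─ q → x ∉ q
  x∈p─q⇒x∉q (_ ∷ p) (false ∷ q) {zero}  _ ()
  x∈p─q⇒x∉q (_ ∷ p) (true  ∷ q) {zero}  ()
  x∈p─q⇒x∉q (_ ∷ p) (_ ∷ q)     {suc x} (Vec.there x∈) (Vec.there x∈q) = x∈p─q⇒x∉q p q x∈ x∈q

  Empty[p─q]⇒p⊆q : ∀ {n} {p q : Subset n} → Empty (p ─ q) → p ⊆ q
  Empty[p─q]⇒p⊆q {q = q} empty {x} x∈p =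
    decidable-stable (x ∈? q) λ x∉q → empty (x , x∈p∧x∉q⇒x∈p─q x∈p x∉q)

  p⊈q⇒Nonempty[p─q] : ∀ {n} {p q : Subset n} → ¬ (p ⊆ q) → Nonempty (p ─ q)
  p⊈q⇒Nonempty[p─q] {p = p} {q} p⊈q =
    decidable-stable (nonempty? (p ─ q)) λ empty → p⊈q (Empty[p─q]⇒p⊆q empty)

  p⊆q∧∣q∣≤∣p∣⇒q⊆p : ∀ {n} {p q : Subset n} → p ⊆ q → ∣ q ∣ ≤ ∣ p ∣ → q ⊆ p
  p⊆q∧∣q∣≤∣p∣⇒q⊆p {p = p} p⊆q ∣q∣≤∣p∣ {x} x∈q =
    decidable-stable (x ∈? p) λ x∉p → <⇒≱ (p⊂q⇒∣p∣<∣q∣ (p⊆q , x , x∈q , x∉p)) ∣q∣≤∣p∣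

  Empty⇒∣p∣≡0 : ∀ {n} {p : Subset n} → Empty p → ∣ p ∣ ≡ 0
  Empty⇒∣p∣≡0 {n} empty = trans (cong ∣_∣ (Empty-unique empty)) (∣⊥∣≡0 n)

  ∣p∣≢0⇒Nonempty : ∀ {n} {p : Subset n} → ∣ p ∣ ≢ 0 → Nonempty p
  ∣p∣≢0⇒Nonempty {p = p} ∣p∣≢0 = decidable-stable (nonempty? p) (∣p∣≢0 ∘ Empty⇒∣p∣≡0)

  ∣p∩q∣+∣p─q∣≡∣p∣ : ∀ {n} (p q : Subset n) → ∣ p ∩ q ∣ + ∣ p ─ q ∣ ≡ ∣ p ∣
  ∣p∩q∣+∣p─q∣≡∣p∣ []          []          = refl
  ∣p∩q∣+∣p─q∣≡∣p∣ (false ∷ p) (false ∷ q) = ∣p∩q∣+∣p─q∣≡∣p∣ p q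
  ∣p∩q∣+∣p─q∣≡∣p∣ (false ∷ p) (true  ∷ q) = ∣p∩q∣+∣p─q∣≡∣p∣ p q
  ∣p∩q∣+∣p─q∣≡∣p∣ (true  ∷ p) (true  ∷ q) = cong suc (∣p∩q∣+∣p─q∣≡∣p∣ p q)
  ∣p∩q∣+∣p─q∣≡∣p∣ (true  ∷ p) (false ∷ q) =
    trans (+-suc ∣ p ∩ q ∣ ∣ p ─ q ∣) (cong suc (∣p∩q∣+∣p─q∣≡∣p∣ p q))

  ∣p∣+∣∁p∣≡n : ∀ {n} (p : Subset n) → ∣ p ∣ + ∣ ∁ p ∣ ≡ n
  ∣p∣+∣∁p∣≡n p = trans (cong (∣ p ∣ +_) (∣∁p∣≡n∸∣p∣ p)) (m+[n∸m]≡n (∣p∣≤n p))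

  ∁∁p⊆p : ∀ {n} {p : Subset n} → ∁ (∁ p) ⊆ p
  ∁∁p⊆p = x∉∁p⇒x∈p ∘ x∈∁p⇒x∉p

-- Partition of a finite set by a subset.

split : ∀ {n} (p : Subset n) → Fin n → Fin ∣ p ∣ ⊎ Fin ∣ ∁ p ∣
split (true  ∷ p) zero    = inj₁ zero
split (false ∷ p) zero    = inj₂ zero
split (true  ∷ p) (suc i) = map₁ suc (split p i)
split (false ∷ p) (suc i) = map₂ suc (split p i)

unsplit : ∀ {n} (p : Subset n) → Fin ∣ p ∣ ⊎ Fin ∣ ∁ p ∣ → Fin n
unsplit []          (inj₁ ())
unsplit []          (inj₂ ())
unsplit (true  ∷ p) (inj₁ zero)    = zero
unsplit (true  ∷ p) (inj₁ (suc i)) = suc (unsplit p (inj₁ i))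
unsplit (true  ∷ p) (inj₂ j)       = suc (unsplit p (inj₂ j))
unsplit (false ∷ p) (inj₁ i)       = suc (unsplit p (inj₁ i))
unsplit (false ∷ p) (inj₂ zero)    = zero
unsplit (false ∷ p) (inj₂ (suc j)) = suc (unsplit p (inj₂ j))

split-unsplit : ∀ {n} (p : Subset n) i → split p (unsplit p i) ≡ i
split-unsplit []          (inj₁ ())
split-unsplit []          (inj₂ ())
split-unsplit (true  ∷ p) (inj₁ zero)    = refl
split-unsplit (true  ∷ p) (inj₁ (suc i)) = cong (map₁ suc) (split-unsplit p (inj₁ i))
split-unsplit (true  ∷ p) (inj₂ j)       = cong (map₁ suc) (split-unsplit p (inj₂ j))
split-unsplit (false ∷ p) (inj₁ i)       = cong (map₂ suc) (split-unsplit p (inj₁ i))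
split-unsplit (false ∷ p) (inj₂ zero)    = refl
split-unsplit (false ∷ p) (inj₂ (suc j)) = cong (map₂ suc) (split-unsplit p (inj₂ j))

unsplit-split : ∀ {n} (p : Subset n) i → unsplit p (split p i) ≡ i
unsplit-split (true  ∷ p) zero    = refl
unsplit-split (false ∷ p) zero    = refl
unsplit-split (true  ∷ p) (suc i) with split p i | unsplit-split p i
... | inj₁ _ | eq = cong suc eq
... | inj₂ _ | eq = cong suc eq
unsplit-split (false ∷ p) (suc i) with split p i | unsplit-split p i
... | inj₁ _ | eq = cong suc eq
... | inj₂ _ | eq = cong suc eq

-- Membership in `p` is `true`, whereas the first block of `completeBipartite` has side `false`;
-- hence the `not`.
split-side : ∀ {n} (p : Subset n) i →
             [ const false , const true ]′ (split p i) ≡ not (Vec.lookup p i)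
split-side (true  ∷ p) zero    = refl
split-side (false ∷ p) zero    = refl
split-side (true  ∷ p) (suc i) with split p i | split-side p i
... | inj₁ _ | eq = eq
... | inj₂ _ | eq = eq
split-side (false ∷ p) (suc i) with split p i | split-side p i
... | inj₁ _ | eq = eq
... | inj₂ _ | eq = eq

split↔ : ∀ {n} (p : Subset n) → Fin n ↔ (Fin ∣ p ∣ ⊎ Fin ∣ ∁ p ∣)
split↔ p = mk↔ₛ′ (split p) (unsplit p) (split-unsplit p) (unsplit-split p)

-- Neighbourhoods and complete bipartite graphs.

module _ {n : ℕ} (G : Graph n) where
  open Graph G renaming (sym to ~-sym)
  open Nat using (_+_; _*_)

  ∈N⁺ : ∀ {v w} → v ~ w → w ∈ N G v
  ∈N⁺ {v} {w} v~w = lookup⇒[]= w _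
    (trans (lookup∘tabulate (λ w → does (v ~? w)) w) (dec-true (v ~? w) v~w))

  ∈N⁻ : ∀ {v w} → w ∈ N G v → v ~ w
  ∈N⁻ {v} {w} w∈ with v ~? w
                    | trans (sym (lookup∘tabulate (λ w → does (v ~? w)) w)) ([]=⇒lookup w∈)
  ... | yes v~w | _  = v~w
  ... | no  _   | ()

  Path-closed : ∀ {ℓ} (P : Fin n → Set ℓ) → (∀ {v w} → v ~ w → P v → P w) →
                ∀ {v w} → Star _~_ v w → P v → P w
  Path-closed P step ε        pv = pv
  Path-closed P step (e ◅ es) pv = Path-closed P step es (step e pv)

  complete⇒≅ : (A : Subset n) → (∀ u v → (u ~ v) ⇔ (Vec.lookup A u ≢ Vec.lookup A v)) →
               G ≅ completeBipartite ∣ A ∣ ∣ ∁ A ∣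
  complete⇒≅ A adj = record
    { vertices = ↔-sym +↔⊎ ↔-∘ split↔ A
    ; adjacent = λ u v → mk⇔
        (λ u~v eq → Equivalence.to (adj u v) u~v
          (not-injective (trans (sym (side u)) (trans eq (side v)))))
        (λ ≢ → Equivalence.from (adj u v) λ eq →
          ≢ (trans (side u) (trans (cong not eq) (sym (side v)))))
    }
    where
    side : ∀ u → [ const false , const true ]′
                   (splitAt ∣ A ∣ (join ∣ A ∣ ∣ ∁ A ∣ (split A u))) ≡ not (Vec.lookup A u)
    side u = trans (cong [ const false , const true ]′ (splitAt-join ∣ A ∣ _ (split A u)))
                   (split-side A u)

  -- Coverings by footprinting steps.

  -- Each step (v , x) consists of a vertex v of the sequence and a vertex x
  -- footprinted by v.
  record Covering (d : ℕ) (E U : Subset n) (a : ℕ) : Set where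
    field
      steps      : List (Fin n × Fin n)
      chosen     : All (λ (v , _) → v ∈ E) steps
      footprints : All (λ (_ , x) → x ∈ U) steps
      adjacent   : All (λ (v , x) → v ~ x) steps
      fresh      : AllPairs (λ (v , _) (_ , y) → ¬ (v ~ y)) steps
      covers     : ∀ {x} → x ∈ U → Any (λ (v , _) → v ~ x) steps
      bound      : a ≤ d * length steps

  private
    variable
      d a b : ℕ
      E E′ U U′ : Subset n

  empty-covering : Empty U → Covering d E U 0
  empty-covering empty = record
    { steps = [] ; chosen = [] ; footprints = [] ; adjacent = [] ; fresh = []
    ; covers = λ x∈U → contradiction (_ , x∈U) empty
    ; bound = z≤n
    }

  -- Every step pays for `d`, however many vertices of `U` it covers. Later footprints lie outside
  -- `N G v`, so freshness persists.
  extend : ∀ {v x} → v ∈ E → v ~ x → x ∈ U → b ≤ d + a →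
           Covering d E (U ─ N G v) a → Covering d E U b
  extend {U = U} {b} {d} {a} {v} {x} v∈E v~x x∈U b≤d+a c = record
    { steps      = (v , x) ∷ steps
    ; chosen     = v∈E ∷ chosen
    ; footprints = x∈U ∷ All.map (p─q⊆p U (N G v)) footprints
    ; adjacent   = v~x ∷ adjacent
    ; fresh      = All.map (λ y∈ v~y → x∈p─q⇒x∉q U (N G v) y∈ (∈N⁺ v~y)) footprints ∷ fresh
    ; covers     = covers′
    ; bound      = begin
        b                          ≤⟨ b≤d+a ⟩
        d + a                      ≤⟨ +-monoʳ-≤ d bound ⟩
        d + d * length steps       ≡⟨ *-suc d (length steps) ⟨
        d * suc (length steps)     ∎
    }
    where
    open Covering c
    open ≤-Reasoning
    covers′ : ∀ {y} → y ∈ U → Any (λ (w , _) → w ~ y) ((v , x) ∷ steps)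
    covers′ {y} y∈U with v ~? y
    ... | yes v~y = here v~y
    ... | no  v≁y = there (covers (x∈p∧x∉q⇒x∈p─q y∈U (v≁y ∘ ∈N⁻)))

  -- The steps of the first covering precede those of the second, so separation is needed in one
  -- direction only.
  merge : (∀ {v y} → v ∈ E → y ∈ U′ → ¬ (v ~ y)) →
          Covering d E U a → Covering d E′ U′ b → Covering d (E ∪ E′) (U ∪ U′) (a + b)
  merge {E} {U′} {d} {U} {a} {E′} {b} separate c c′ = record
    { steps      = C.steps ++ C′.steps
    ; chosen     = All.++⁺ (All.map (λ v∈ → x∈p∪q⁺ (inj₁ v∈)) C.chosen)
                           (All.map (λ v∈ → x∈p∪q⁺ (inj₂ v∈)) C′.chosen)
    ; footprints = All.++⁺ (All.map (λ v∈ → x∈p∪q⁺ (inj₁ v∈)) C.footprints)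
                           (All.map (λ v∈ → x∈p∪q⁺ (inj₂ v∈)) C′.footprints)
    ; adjacent   = All.++⁺ C.adjacent C′.adjacent
    ; fresh      = AllPairs.++⁺ C.fresh C′.fresh
                     (All.map (λ v∈E → All.map (separate v∈E) C′.footprints) C.chosen)
    ; covers     = λ x∈ → [ Any.++⁺ˡ ∘ C.covers , Any.++⁺ʳ C.steps ∘ C′.covers ]′
                            (x∈p∪q⁻ U U′ x∈)
    ; bound      = begin
        a + b                                            ≤⟨ +-mono-≤ C.bound C′.bound ⟩
        d * length C.steps + d * length C′.steps         ≡⟨ *-distribˡ-+ d (length C.steps) _ ⟨
        d * (length C.steps + length C′.steps)           ≡⟨ cong (d *_) (length-++ C.steps) ⟨
        d * length (C.steps ++ C′.steps)                 ∎
    }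
    where
    module C = Covering c
    module C′ = Covering c′
    open ≤-Reasoning

  -- From coverings to total dominating sequences.

  ∈⋃N⁻ : ∀ {x} S → x ∈ ⋃ (map (N G) S) → Any (_~ x) S
  ∈⋃N⁻ []      x∈ = contradiction x∈ ∉⊥
  ∈⋃N⁻ (v ∷ S) x∈ with x∈p∪q⁻ (N G v) _ x∈
  ... | inj₁ x∈N = here (∈N⁻ x∈N)
  ... | inj₂ x∈⋃ = there (∈⋃N⁻ S x∈⋃)

  -- The last conjunct serves the induction: a vertex put in front is known to be non-adjacent to
  -- the footprints listed in `L`.
  fresh⇒footprint : ∀ {L : List (Fin n × Fin n)} → All (λ (v , x) → v ~ x) L →
    AllPairs (λ (v , _) (_ , y) → ¬ (v ~ y)) L → let S = map proj₁ L in
    ∀ (i : Fin (length S)) → ∃ λ x → lookup S i ~ x × ¬ Any (_~ x) (take (toℕ i) S) × Any ((x ≡_) ∘ proj₂) L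
  fresh⇒footprint {(v , x) ∷ _} (v~x ∷ _)  _           zero    = x , v~x , (λ ()) , here refl
  fresh⇒footprint               (_ ∷ adj) (v≁ ∷ fresh) (suc i)
    with y , w~y , fr , y∈ ← fresh⇒footprint adj fresh i =
    y , w~y , (λ { (here v~y) → All.All¬⇒¬Any (All.map (λ { v≁z refl → v≁z v~y }) v≁) y∈
                 ; (there any) → fr any }) , there y∈

  -- Footprints make the chosen vertices distinct and the sequence legal; covering `⊤` makes it
  -- totally dominating.
  covering⇒≤γ : Covering d E ⊤ a → a ≤ d * γᵗgr G
  covering⇒≤γ {d} {E} {a} c = begin
    a                   ≤⟨ bound ⟩
    d * length steps    ≡⟨ cong (d *_) (length-map proj₁ steps) ⟨
    d * length S        ≤⟨ *-monoʳ-≤ d (γᵗgr-upper G (legal distinct footprint , total)) ⟩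
    d * γᵗgr G          ∎
    where
    open Covering c
    open ≤-Reasoning
    S = map proj₁ steps
    unique : ∀ {L} → All (λ (v , x) → v ~ x) L →
      AllPairs (λ (v , _) (_ , y) → ¬ (v ~ y)) L → AllPairs (λ p q → proj₁ p ≢ proj₁ q) L
    unique []        []          = []
    unique (_ ∷ adj) (v≁ ∷ fresh) =
      All.zipWith (λ { (v≁y , w~y) refl → v≁y w~y }) (v≁ , adj) ∷ unique adj fresh
    distinct = AllPairs.map⁺ (unique adjacent fresh)
    footprint : ∀ (i : Fin (length S)) → 0 < toℕ i →
                Nonempty (N G (lookup S i) ─ ⋃ (map (N G) (take (toℕ i) S)))
    footprint i _ with x , v~x , new , _ ← fresh⇒footprint adjacent fresh i =
      x , x∈p∧x∉q⇒x∈p─q (∈N⁺ v~x) (new ∘ ∈⋃N⁻ (take (toℕ i) S))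
    total : IsTotalDominatingSet G (List._∈ S)
    total x with (v , _) , v∈ , v~x ← List.find (covers {x} ∈⊤) =
      v , ∈-map⁺ proj₁ v∈ , ~-sym v~x

  -- Greedy coverings in a regular graph.

  module Greedy (d : ℕ) (regular : IsRegular G (suc d)) where

    someNeighbour : ∀ v → ∃ (v ~_)
    someNeighbour v with x , x∈ ← ∣p∣≢0⇒Nonempty {p = N G v}
      (λ ∣N∣≡0 → 1+n≢0 (trans (sym (regular v)) ∣N∣≡0)) = x , ∈N⁻ x∈

    -- Equal sizes turn inclusion into equality. Below, `¬ (N G w ⊆ N G v)` therefore expresses that
    -- the two neighbourhoods are distinct.
    N⊆⇒N⊇ : ∀ {v w} → N G v ⊆ N G w → N G w ⊆ N G v
    N⊆⇒N⊇ {v} {w} N⊆ =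
      p⊆q∧∣q∣≤∣p∣⇒q⊆p N⊆ (≤-reflexive (trans (regular w) (sym (regular v))))

    ∣p∩N∣≤1+d : ∀ p v → ∣ p ∩ N G v ∣ ≤ suc d
    ∣p∩N∣≤1+d p v = ≤-trans (∣p∩q∣≤∣q∣ p (N G v)) (≤-reflexive (regular v))

    ∣p∩N∣≤d : ∀ {p v z} → v ~ z → z ∉ p → ∣ p ∩ N G v ∣ ≤ d
    ∣p∩N∣≤d {p} {v} {z} v~z z∉p = s≤s⁻¹ (subst (∣ p ∩ N G v ∣ <_) (regular v)
      (p⊂q⇒∣p∣<∣q∣ (p∩q⊆q p (N G v) , z , ∈N⁺ v~z , z∉p ∘ proj₁ ∘ x∈p∩q⁻ p (N G v))))
      where open Nat using (s≤s⁻¹)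

    remainder-⊂ : ∀ {U v y} → v ~ y → y ∈ U → U ─ N G v ⊂ U
    remainder-⊂ {U} {v} {y} v~y y∈U = p∩q≢∅⇒p─q⊂p U (N G v) (y , x∈p∩q⁺ (y∈U , ∈N⁺ v~y))

    ∈-remainder⁻ : ∀ {U v c} → c ∉ U ─ N G v → c ∉ U ⊎ v ~ c
    ∈-remainder⁻ {U} {v} {c} c∉ with v ~? c
    ... | yes v~c = inj₂ v~c
    ... | no  v≁c = inj₁ λ c∈U → c∉ (x∈p∧x∉q⇒x∈p─q c∈U (v≁c ∘ ∈N⁻))

    weight : ∀ U v t {e} → ∣ U ∩ N G v ∣ ≤ e → ∣ U ∣ + t ≤ e + (∣ U ─ N G v ∣ + t)
    weight U v t {e} ≤e = begin
      ∣ U ∣ + t                              ≡⟨ cong (_+ t) (∣p∩q∣+∣p─q∣≡∣p∣ U (N G v)) ⟨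
      ∣ U ∩ N G v ∣ + ∣ U ─ N G v ∣ + t      ≡⟨ +-assoc ∣ U ∩ N G v ∣ _ t ⟩
      ∣ U ∩ N G v ∣ + (∣ U ─ N G v ∣ + t)    ≤⟨ +-monoˡ-≤ _ ≤e ⟩
      e + (∣ U ─ N G v ∣ + t)                ∎
      where open ≤-Reasoning

    -- This is connectedness of the hypergraph of open neighbourhoods on `T`, stated through
    -- nonempty proper subsets of `T`.
    Crossing : Subset n → Set
    Crossing T = ∀ {U x c} → U ⊆ T → x ∈ U → c ∈ T → c ∉ U →
                 ∃ λ v → ∃ λ y → ∃ λ z → y ∈ U × z ∉ U × v ~ y × v ~ z

    -- T and E are the vertex and edge sets of a component of the hypergraph of open
    -- neighbourhoods, where v ∈ E stands for the edge N G v.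
    module Component (T E : Subset n)
      (T→E : ∀ {x v} → x ∈ T → x ~ v → v ∈ E)
      (E→T : ∀ {v x} → v ∈ E → v ~ x → x ∈ T)
      (crossing : Crossing T)
      where

      remainder-⊆ : ∀ {U} v → U ⊆ T → U ─ N G v ⊆ T
      remainder-⊆ {U} v U⊆T = U⊆T ∘ p─q⊆p U (N G v)

      -- The covered vertex `c` stays outside `U`, so `crossing` applies while `U` is nonempty. The
      -- neighbour `z` of `v` outside `U` limits each step to `d` new vertices.
      greedy : ∀ {U c} → Acc _⊂_ U → U ⊆ T → c ∈ T → c ∉ U → Covering d E U ∣ U ∣
      greedy {U} (acc rs) U⊆T c∈T c∉U with nonempty? U
      ... | no  empty = subst (Covering d E U) (sym (Empty⇒∣p∣≡0 empty)) (empty-covering empty)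
      ... | yes (x , x∈U)
        with v , y , z , y∈U , z∉U , v~y , v~z ← crossing U⊆T x∈U c∈T c∉U =
        extend (T→E (U⊆T y∈U) (~-sym v~y)) v~y y∈U
          (subst₂ _≤_ (+-identityʳ _) (cong (d +_) (+-identityʳ _))
            (weight U v 0 (∣p∩N∣≤d v~z z∉U)))
          (greedy (rs (remainder-⊂ v~y y∈U)) (remainder-⊆ v U⊆T) c∈T (c∉U ∘ p─q⊆p U (N G v)))

      Spread : ℕ → Set
      Spread s = ∀ v w → v ∈ E → w ∈ E → ¬ (N G w ⊆ N G v) → ∣ N G w ∩ N G v ∣ ≤ s

      -- T ─ U is the union of the neighbourhoods chosen so far.
      Saturated : Subset n → Set
      Saturated U = ∀ {c} → c ∈ T → c ∉ U → ∃ λ f → f ~ c × Empty (U ∩ N G f)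

      remainder-saturated : ∀ {U} v → Saturated U → Saturated (U ─ N G v)
      remainder-saturated {U} v sat {c} c∈T c∉ with ∈-remainder⁻ c∉
      ... | inj₂ v~c = v , v~c , λ (x , x∈) →
              let x∈─ , x∈N = x∈p∩q⁻ (U ─ N G v) (N G v) x∈ in x∈p─q⇒x∉q U (N G v) x∈─ x∈N
      ... | inj₁ c∉U with f , f~c , empty ← sat c∈T c∉U = f , f~c , λ (x , x∈) →
              let x∈─ , x∈N = x∈p∩q⁻ (U ─ N G v) (N G f) x∈ in
              empty (x , x∈p∩q⁺ (p─q⊆p U (N G v) x∈─ , x∈N))

      -- A step that would cover all of U is postponed if some vertex leaves a part
      -- of U uncovered.  So the last step starts from a set U contained in two
      -- distinct neighbourhoods, which has at most s elements.  If y ∈ U had only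
      -- one neighbourhood around it, then so would some z ∈ T ─ U, and
      -- y would have been covered together with z.
      greedy-saving : ∀ {s U x c} → s + s ≤ d → Spread s → Acc _⊂_ U → Saturated U →
                      U ⊆ T → x ∈ U → c ∈ T → c ∉ U → Covering d E U (∣ U ∣ + s)
      greedy-saving {s} {U} {x} {c} 2s≤d spread (acc rs) sat U⊆T x∈U c∈T c∉U
        with v , y , z , y∈U , z∉U , v~y , v~z ← crossing U⊆T x∈U c∈T c∉U
        = postpone
        where
        continue : ∀ {w} → w ~ y → ∣ U ∩ N G w ∣ ≤ d → Nonempty (U ─ N G w) →
                   Covering d E U (∣ U ∣ + s)
        continue {w} w~y ≤d (_ , x′∈) =
          extend (T→E (U⊆T y∈U) (~-sym w~y)) w~y y∈U (weight U w s ≤d)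
            (greedy-saving 2s≤d spread (rs (remainder-⊂ w~y y∈U)) (remainder-saturated w sat)
              (remainder-⊆ w U⊆T) x′∈ c∈T (c∉U ∘ p─q⊆p U (N G w)))

        finish : ∀ {w} → w ~ y → ¬ (N G w ⊆ N G v) → U ⊆ N G v → U ⊆ N G w →
                 Covering d E U (∣ U ∣ + s)
        finish {w} w~y N⊈ U⊆Nv U⊆Nw =
          extend (T→E (U⊆T y∈U) (~-sym w~y)) w~y y∈U
            -- The last step pays for `d`, and `∣ U ∣ + s ≤ s + s ≤ d`, so the whole saving is made
            -- here.
            (≤-trans (≤-trans (+-monoˡ-≤ s ∣U∣≤s) 2s≤d) (m≤m+n d 0))
            (empty-covering λ (x , x∈) →
              x∈p─q⇒x∉q U (N G w) x∈ (U⊆Nw (p─q⊆p U (N G w) x∈)))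
          where
          ∣U∣≤s : ∣ U ∣ ≤ s
          ∣U∣≤s = ≤-trans (p⊆q⇒∣p∣≤∣q∣ (λ x∈U → x∈p∩q⁺ (U⊆Nw x∈U , U⊆Nv x∈U)))
            (spread v w (T→E (U⊆T y∈U) (~-sym v~y)) (T→E (U⊆T y∈U) (~-sym w~y)) N⊈)

        z∈T : z ∈ T
        z∈T = E→T (T→E (U⊆T y∈U) (~-sym v~y)) v~z

        twins-impossible : ¬ (∀ w → w ~ y → N G w ⊆ N G v)
        twins-impossible same with f , f~z , empty ← sat z∈T z∉U =
          empty (y , x∈p∩q⁺ (y∈U , ∈N⁺ (~-sym (∈N⁻ (N⊆⇒N⊇ Ny⊆Nz (∈N⁺ (~-sym f~z)))))))
          where
          -- A neighbour `w` of `y` has the same neighbourhood as `v` by `same` and regularity, so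
          -- `w ~ z`. By regularity again `N G y` equals `N G z`; hence `f ~ y`, although
          -- `U ∩ N G f` is empty.
          Ny⊆Nz : N G y ⊆ N G z
          Ny⊆Nz {w} w∈ = ∈N⁺ (~-sym (∈N⁻ (N⊆⇒N⊇ (same w (~-sym (∈N⁻ w∈))) (∈N⁺ v~z))))

        ∣U∩N∣≤d : U ⊆ N G v → ∀ w → ∣ U ∩ N G w ∣ ≤ d
        ∣U∩N∣≤d U⊆Nv w = ≤-trans (∣p∩q∣≤∣p∣ U (N G w))
          (≤-trans (p⊆q⇒∣p∣≤∣q∣ (λ x∈U → x∈p∩q⁺ (x∈U , U⊆Nv x∈U))) (∣p∩N∣≤d v~z z∉U))

        last-step : U ⊆ N G v → Covering d E U (∣ U ∣ + s)
        last-step U⊆Nv with any? (λ w → w ~? y ×-dec ¬? (N G w ⊆? N G v))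
        ... | no  none = ⊥-elim (twins-impossible λ w w~y →
                decidable-stable (N G w ⊆? N G v) λ N⊈ → none (w , w~y , N⊈))
        ... | yes (w , w~y , N⊈) with U ⊆? N G w
        ...   | yes U⊆Nw = finish w~y N⊈ U⊆Nv U⊆Nw
        -- `N G w` contains `y` but not all of `U`: stepping with `w` instead of `v` makes progress
        -- and still postpones the last step.
        ...   | no  U⊈Nw = continue w~y (∣U∩N∣≤d U⊆Nv w) (p⊈q⇒Nonempty[p─q] U⊈Nw)

        postpone : Covering d E U (∣ U ∣ + s)
        postpone with nonempty? (U ─ N G v)
        ... | yes nonempty = continue v~y (∣p∩N∣≤d v~z z∉U) nonempty
        ... | no  empty    = last-step (Empty[p─q]⇒p⊆q empty)

      -- The first step may cover `suc d` vertices, one more than it pays for; hence the `∸ 1`.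
      after-first : ∀ {s v t} → t ∈ T → v ~ t → Covering d E (T ─ N G v) (∣ T ─ N G v ∣ + s) →
                    Covering d E T (∣ T ∣ + s ∸ 1)
      after-first {s} {v} {t} t∈T v~t =
        extend (T→E t∈T (~-sym v~t)) v~t t∈T (∸-monoˡ-≤ 1 (weight T v s (∣p∩N∣≤1+d T v)))

      -- After `v`, the step `w` covers at most `d - s` new vertices, because more than `s` of the
      -- `d + 1` elements of `N G w` are already covered. This gives the whole saving; plain
      -- `greedy` does the rest.
      overlapping : ∀ {s} v w → v ∈ E → w ∈ E → ¬ (N G w ⊆ N G v) → s < ∣ N G w ∩ N G v ∣ →
                    Covering d E T (∣ T ∣ + s ∸ 1)
      overlapping {s} v w v∈E w∈E N⊈ s<
        with t , v~t ← someNeighbour v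
           | x , x∈ ← p⊈q⇒Nonempty[p─q] N⊈ =
        after-first t∈T v~t
          (extend w∈E w~x x∈R bound
            (greedy (⊂-wellFounded _) (remainder-⊆ w (remainder-⊆ v id)) t∈T
              (t∉R ∘ p─q⊆p R (N G w))))
        where
        R = T ─ N G v
        t∈T = E→T v∈E v~t
        w~x = ∈N⁻ (p─q⊆p (N G w) (N G v) x∈)
        x∈R = x∈p∧x∉q⇒x∈p─q (E→T w∈E w~x) (x∈p─q⇒x∉q (N G w) (N G v) x∈)
        t∉R : t ∉ R
        t∉R t∈R = x∈p─q⇒x∉q T (N G v) t∈R (∈N⁺ v~t)
        R∩Nw⊆ : R ∩ N G w ⊆ N G w ─ N G v
        R∩Nw⊆ x∈ = let x∈R , x∈N = x∈p∩q⁻ R (N G w) x∈ in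
                   x∈p∧x∉q⇒x∈p─q x∈N (x∈p─q⇒x∉q T (N G v) x∈R)
        open ≤-Reasoning
        new : ∣ R ∩ N G w ∣ + s ≤ d
        new = Nat.s≤s⁻¹ (begin
          suc (∣ R ∩ N G w ∣ + s)                    ≡⟨ +-suc ∣ R ∩ N G w ∣ s ⟨
          ∣ R ∩ N G w ∣ + suc s                      ≤⟨ +-mono-≤ (p⊆q⇒∣p∣≤∣q∣ R∩Nw⊆) s< ⟩
          ∣ N G w ─ N G v ∣ + ∣ N G w ∩ N G v ∣      ≡⟨ +-comm ∣ N G w ─ N G v ∣ _ ⟩
          ∣ N G w ∩ N G v ∣ + ∣ N G w ─ N G v ∣      ≡⟨ ∣p∩q∣+∣p─q∣≡∣p∣ (N G w) (N G v) ⟩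
          ∣ N G w ∣                                  ≡⟨ regular w ⟩
          suc d                                      ∎)
        bound : ∣ R ∣ + s ≤ d + ∣ R ─ N G w ∣
        bound = begin
          ∣ R ∣ + s                                  ≡⟨ cong (_+ s) (∣p∩q∣+∣p─q∣≡∣p∣ R (N G w)) ⟨
          ∣ R ∩ N G w ∣ + ∣ R ─ N G w ∣ + s          ≡⟨ +-assoc ∣ R ∩ N G w ∣ _ s ⟩
          ∣ R ∩ N G w ∣ + (∣ R ─ N G w ∣ + s)        ≡⟨ cong (∣ R ∩ N G w ∣ +_) (+-comm _ s) ⟩
          ∣ R ∩ N G w ∣ + (s + ∣ R ─ N G w ∣)        ≡⟨ +-assoc ∣ R ∩ N G w ∣ s _ ⟨
          ∣ R ∩ N G w ∣ + s + ∣ R ─ N G w ∣          ≤⟨ +-monoˡ-≤ _ new ⟩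
          d + ∣ R ─ N G w ∣                          ∎

      -- As `T` is larger than a single neighbourhood, vertices remain after the first step, as
      -- `greedy-saving` requires.
      nonoverlapping : ∀ {s} → s + s ≤ d → Spread s → suc d < ∣ T ∣ →
                       Covering d E T (∣ T ∣ + s ∸ 1)
      nonoverlapping {s} 2s≤d spread 1+d<∣T∣
        with t , t∈T ← ∣p∣≢0⇒Nonempty {p = T} (λ ∣T∣≡0 → n≮0 (subst (suc d <_) ∣T∣≡0 1+d<∣T∣))
        with v , t~v ← someNeighbour t
        with x , x∈ ← p⊈q⇒Nonempty[p─q] {p = T} {N G v}
               (λ T⊆N → <⇒≱ 1+d<∣T∣ (≤-trans (p⊆q⇒∣p∣≤∣q∣ T⊆N) (≤-reflexive (regular v)))) =
        after-first t∈T (~-sym t~v)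
          (greedy-saving 2s≤d spread (⊂-wellFounded _) saturated (remainder-⊆ v id) x∈ t∈T
            (λ t∈U → x∈p─q⇒x∉q T (N G v) t∈U (∈N⁺ (~-sym t~v))))
        where
        saturated : Saturated (T ─ N G v)
        saturated = remainder-saturated v λ c∈T c∉T → contradiction c∈T c∉T

      component-covering : ∀ {s} → s + s ≤ d → suc d < ∣ T ∣ → Covering d E T (∣ T ∣ + s ∸ 1)
      component-covering {s} 2s≤d 1+d<∣T∣
        with any? (λ v → any? λ w → v ∈? E ×-dec w ∈? E ×-dec ¬? (N G w ⊆? N G v)
                                    ×-dec s <? ∣ N G w ∩ N G v ∣)
      ... | yes (v , w , v∈E , w∈E , N⊈ , s<) = overlapping v w v∈E w∈E N⊈ s<
      ... | no  none = nonoverlapping 2s≤d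
              (λ v w v∈E w∈E N⊈ → ≮⇒≥ λ s< → none (v , w , v∈E , w∈E , N⊈ , s<)) 1+d<∣T∣

    -- Connectedness of the hypergraph, and the two cases.

    module _ (connected : ∀ u v → Star _~_ u v) where

      mixed? : ∀ U → Dec (∃ λ v → ∃ λ y → ∃ λ z → y ∈ U × z ∉ U × v ~ y × v ~ z)
      mixed? U = any? λ v → any? λ y → any? λ z →
        y ∈? U ×-dec ¬? (z ∈? U) ×-dec v ~? y ×-dec v ~? z

      -- If every neighbourhood lies inside U or inside its complement and some edge
      -- a ~ b does not cross between the two, then no edge does, as all vertices
      -- lie on the side of a.  Otherwise U and its complement bipartition G.
      crossing-nonbipartite : ¬ IsBipartite G → Crossing ⊤
      crossing-nonbipartite nonbip {U} {x} {c} _ x∈U _ c∉U with mixed? U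
      ... | yes mixed = mixed
      ... | no  none  = contradiction (U , inside , outside) nonbip
        where
        same : ∀ {v y z} → v ~ y → v ~ z → y ∈ U → z ∈ U
        same {v} {y} {z} v~y v~z y∈U =
          decidable-stable (z ∈? U) λ z∉U → none (v , y , z , y∈U , z∉U , v~y , v~z)
        inside : IsIndependent G U
        inside a b a∈U b∈U a~b = c∉U (proj₁ (Path-closed
          (λ v → v ∈ U × ∃ λ w → v ~ w × w ∈ U)
          (λ { v~w (v∈U , v′ , v~v′ , v′∈U) → same v~v′ v~w v′∈U , _ , ~-sym v~w , v∈U })
          (connected a c) (a∈U , b , a~b , b∈U)))
        outside : IsIndependent G (∁ U)
        outside a b a∈∁U b∈∁U a~b = proj₁ (Path-closed
          (λ v → v ∉ U × ∃ λ w → v ~ w × w ∉ U)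
          (λ { v~w (v∉U , v′ , v~v′ , v′∉U) →
             v′∉U ∘ same v~w v~v′ , _ , ~-sym v~w , v∉U })
          (connected a x) (x∈∁p⇒x∉p a∈∁U , b , a~b , x∈∁p⇒x∉p b∈∁U)) x∈U

      module _ {A : Subset n} (indep : IsIndependent G A) (indep′ : IsIndependent G (∁ A)) where

        ∈A⇒∈∁A : ∀ {v w} → v ∈ A → v ~ w → w ∈ ∁ A
        ∈A⇒∈∁A v∈A v~w = x∉p⇒x∈∁p λ w∈A → indep _ _ v∈A w∈A v~w

        ∈∁A⇒∈A : ∀ {v w} → v ∈ ∁ A → v ~ w → w ∈ A
        ∈∁A⇒∈A v∈∁A v~w = x∉∁p⇒x∈p λ w∈∁A → indep′ _ _ v∈∁A w∈∁A v~w

        -- If no neighbourhood is mixed, then along a walk from `x` each vertex is in `U`, or is in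
        -- `∁ A` and has a neighbour in `U`. At `c` both alternatives fail.
        crossing-bipartite : Crossing A
        crossing-bipartite {U} {x} {c} U⊆A x∈U c∈A c∉U with mixed? U
        ... | yes mixed = mixed
        ... | no  none with Path-closed (λ v → v ∈ U ⊎ (v ∈ ∁ A × ∃ λ w → v ~ w × w ∈ U)) step
                              (connected x c) (inj₁ x∈U)
          where
          step : ∀ {v w} → v ~ w → v ∈ U ⊎ (v ∈ ∁ A × ∃ λ u → v ~ u × u ∈ U) →
                 w ∈ U ⊎ (w ∈ ∁ A × ∃ λ u → w ~ u × u ∈ U)
          step v~w (inj₁ v∈U) = inj₂ (∈A⇒∈∁A (U⊆A v∈U) v~w , _ , ~-sym v~w , v∈U)
          step {v} {w} v~w (inj₂ (v∈∁A , u , v~u , u∈U)) = inj₁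
            (decidable-stable (w ∈? U) λ w∉U → none (v , u , w , u∈U , w∉U , v~u , v~w))
        ...   | inj₁ c∈U         = contradiction c∈U c∉U
        ...   | inj₂ (c∈∁A , _) = contradiction c∈A (x∈∁p⇒x∉p c∈∁A)

        -- For `v ∈ ∁ A`, the set `N G v` lies in `A` and is at least as large, so it is all of `A`
        -- and every edge between the classes is present. Excluding this case makes each class
        -- larger than a neighbourhood.
        bipartite-small⇒≅ : Fin n → ∣ A ∣ ≤ suc d → G ≅ completeBipartite (suc d) (suc d)
        bipartite-small⇒≅ x ∣A∣≤1+d =
          subst₂ (λ a b → G ≅ completeBipartite a b) ∣A∣≡1+d ∣∁A∣≡1+d (complete⇒≅ A adj)
          where
          N≡A : ∀ {v} → v ∈ ∁ A → A ⊆ N G v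
          N≡A {v} v∈∁A = p⊆q∧∣q∣≤∣p∣⇒q⊆p (∈∁A⇒∈A v∈∁A ∘ ∈N⁻)
            (≤-trans ∣A∣≤1+d (≤-reflexive (sym (regular v))))

          both : (∃ (_∈ A)) × (∃ (_∈ ∁ A))
          both with x ∈? A | someNeighbour x
          ... | yes x∈A | y , x~y = (x , x∈A) , (y , ∈A⇒∈∁A x∈A x~y)
          ... | no  x∉A | y , x~y = (y , ∈∁A⇒∈A (x∉p⇒x∈∁p x∉A) x~y) , (x , x∉p⇒x∈∁p x∉A)

          ∣A∣≡1+d : ∣ A ∣ ≡ suc d
          ∣A∣≡1+d with v , v∈ ← proj₂ both = ≤-antisym ∣A∣≤1+d
            (≤-trans (≤-reflexive (sym (regular v))) (p⊆q⇒∣p∣≤∣q∣ (∈∁A⇒∈A v∈ ∘ ∈N⁻)))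

          ∣∁A∣≡1+d : ∣ ∁ A ∣ ≡ suc d
          ∣∁A∣≡1+d with u , u∈ ← proj₁ both = trans
            (cong ∣_∣ (⊆-antisym (λ w∈ → ∈N⁺ (~-sym (∈N⁻ (N≡A w∈ u∈)))) (∈A⇒∈∁A u∈ ∘ ∈N⁻)))
            (regular u)

          ∉⁻ : ∀ {v} → Vec.lookup A v ≡ false → v ∈ ∁ A
          ∉⁻ eq = x∉p⇒x∈∁p λ v∈A → contradiction (trans (sym ([]=⇒lookup v∈A)) eq) λ ()

          adj : ∀ u v → (u ~ v) ⇔ (Vec.lookup A u ≢ Vec.lookup A v)
          adj u v = mk⇔ to from
            where
            to : u ~ v → Vec.lookup A u ≢ Vec.lookup A v
            to u~v eq with Vec.lookup A u in u≡
            ... | true  = indep u v (lookup⇒[]= u A u≡) (lookup⇒[]= v A (sym eq)) u~v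
            ... | false = indep′ u v (∉⁻ u≡) (∉⁻ (sym eq)) u~v
            from : Vec.lookup A u ≢ Vec.lookup A v → u ~ v
            from ≢ with Vec.lookup A u in u≡ | Vec.lookup A v in v≡
            ... | true  | true  = contradiction refl ≢
            ... | false | false = contradiction refl ≢
            ... | true  | false = ~-sym (∈N⁻ (N≡A (∉⁻ v≡) (lookup⇒[]= u A u≡)))
            ... | false | true  = ∈N⁻ (N≡A (∉⁻ u≡) (lookup⇒[]= v A v≡))

        class-covering : ∀ s → s + s ≤ d → suc d < ∣ A ∣ →
                         Covering d (∁ A) A (∣ A ∣ + s ∸ 1)
        class-covering s = Component.component-covering A (∁ A) ∈A⇒∈∁A ∈∁A⇒∈A crossing-bipartite

      nonbipartite-bound : ∀ {s} → s + s ≤ d → Fin n → ¬ IsBipartite G → n + s ∸ 1 ≤ d * γᵗgr G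
      nonbipartite-bound {s} 2s≤d v nonbip =
        covering⇒≤γ (subst (λ m → Covering d ⊤ ⊤ (m + s ∸ 1)) (∣⊤∣≡n n)
          (Component.component-covering ⊤ ⊤ (λ _ _ → ∈⊤) (λ _ _ → ∈⊤)
            (crossing-nonbipartite nonbip) 2s≤d
            (subst (_< ∣ ⊤ {n} ∣) (regular v)
              (p⊂q⇒∣p∣<∣q∣ (⊆⊤ , v , ∈⊤ , irrefl refl ∘ ∈N⁻)))))

      -- Each class has its own saving `s` and its own loss of 1 in the first step. Positivity of
      -- the classes is returned so that `∸` can be read as integer subtraction.
      bipartite-bound : ∀ {s} → s + s ≤ d → Fin n → ¬ (G ≅ completeBipartite (suc d) (suc d)) →
        ((A , _) : IsBipartite G) →
        1 ≤ ∣ A ∣ × 1 ≤ ∣ ∁ A ∣ × (∣ A ∣ + s ∸ 1) + (∣ ∁ A ∣ + s ∸ 1) ≤ d * γᵗgr G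
      bipartite-bound {s} 2s≤d v ≇ (A , indep , indep′) =
        ≤-trans (s≤s z≤n) 1+d<∣A∣ , ≤-trans (s≤s z≤n) 1+d<∣∁A∣ ,
        covering⇒≤γ (subst (λ U → Covering d (∁ A ∪ ∁ (∁ A)) U
                              ((∣ A ∣ + s ∸ 1) + (∣ ∁ A ∣ + s ∸ 1))) (p∪∁p≡⊤ A)
          (merge (λ v∈ → indep′ _ _ v∈) (class-covering indep indep′ s 2s≤d 1+d<∣A∣)
            (class-covering indep′ indep″ s 2s≤d 1+d<∣∁A∣)))
        where
        indep″ : IsIndependent G (∁ (∁ A))
        indep″ u v u∈ v∈ = indep u v (∁∁p⊆p u∈) (∁∁p⊆p v∈)
        1+d<∣A∣ = ≰⇒> (≇ ∘ bipartite-small⇒≅ indep indep′ v)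
        1+d<∣∁A∣ = ≰⇒> (≇ ∘ bipartite-small⇒≅ indep′ indep″ v)

-- Rational form of the bounds.

open import Data.Integer.Base using (+_; _+_; _-_; _*_)
open import Data.Rational.Base using (_/_; _≥_)

+[c+e]-c≡e : ∀ c e → + (c Nat.+ e) - + c ≡ + e
+[c+e]-c≡e c e = trans (ℤ.m-n≡m⊖n (c Nat.+ e) c)
  (trans (ℤ.⊖-≥ (m≤m+n c e)) (cong +_ (m+n∸m≡n c e)))

-- Unnormalised rationals reduce the claim to cross-multiplication. The equation `z ≡ + e` lets the
-- numerator keep the form it has in the theorem.
e≤d*γ⇒γ≥e/d : ∀ d e γ z → z ≡ + e → e ≤ suc d Nat.* γ → + γ / 1 ≥ z / suc d
e≤d*γ⇒γ≥e/d d e γ _ refl e≤ = ℚ.toℚᵘ-cancel-≤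
  (ℚᵘ.≤-respˡ-≃ (ℚᵘ.≃-sym (ℚ.toℚᵘ-fromℚᵘ (ℚᵘ.mkℚᵘ (+ e) d)))
    (ℚᵘ.≤-respʳ-≃ (ℚᵘ.≃-sym (ℚ.toℚᵘ-fromℚᵘ (ℚᵘ.mkℚᵘ (+ γ) 0))) (ℚᵘ.*≤* cross)))
  where
  cross : + e * + 1 ℤ.≤ + γ * + suc d
  cross = subst₂ ℤ._≤_ (sym (ℤ.*-identityʳ (+ e)))
    (trans (cong +_ (*-comm (suc d) γ)) (ℤ.pos-* γ (suc d))) (ℤ.+≤+ e≤)

nonbipartite-numerator : ∀ n s → 1 ≤ n → + n + + suc s - + 2 ≡ + (n Nat.+ s ∸ 1)
nonbipartite-numerator (suc n) s _ =
  trans (cong (λ m → + m - + 2) (cong suc (+-suc n s))) (+[c+e]-c≡e 2 (n Nat.+ s))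

bipartite-numerator : ∀ a b s → 1 ≤ a → 1 ≤ b →
  + (a Nat.+ b) + + 2 * + suc s - + 4 ≡ + ((a Nat.+ s ∸ 1) Nat.+ (b Nat.+ s ∸ 1))
bipartite-numerator (suc a) (suc b) s _ _ =
  trans (cong (λ m → + m - + 4) (solve 3 (λ a b s →
    con 1 :+ a :+ (con 1 :+ b) :+ con 2 :* (con 1 :+ s) := con 4 :+ ((a :+ s) :+ (b :+ s)))
    refl a b s)) (+[c+e]-c≡e 4 ((a Nat.+ s) Nat.+ (b Nat.+ s)))
  where open +-*-Solver

⌊n/2⌋+⌊n/2⌋≤n : ∀ n → ⌊ n /2⌋ Nat.+ ⌊ n /2⌋ ≤ n
⌊n/2⌋+⌊n/2⌋≤n n =
  ≤-trans (+-monoʳ-≤ ⌊ n /2⌋ (⌊n/2⌋≤⌈n/2⌉ n)) (≤-reflexive (⌊n/2⌋+⌈n/2⌉≡n n))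

mainTheorem13 : (k : ℕ) (3≤k : 3 ≤ k) {n : ℕ} (G : Graph n) →
    IsConnected G → IsRegular G k → ¬ (G ≅ completeBipartite k k) →
    let instance k-1≢0 = 3≤k⇒k∸1≢0 3≤k in
    (¬ IsBipartite G →
    + γᵗgr G / 1 ≥ (+ n + + ⌈ k /2⌉ - + 2) / (k ∸ 1)) ×
    (IsBipartite G →
    + γᵗgr G / 1 ≥ (+ n + + 2 * + ⌈ k /2⌉ - + 4) / (k ∸ 1))
mainTheorem13 (suc (suc d)) (s≤s (s≤s _)) {suc n} G (_ , connected) regular ≇ =
  nonbipartite , bipartite
  where
  -- Here `d` is `k - 2`, so each step pays for `suc d`, that is `k - 1`, and `⌈ k /2⌉` reduces to
  -- `suc s`.
  s = ⌊ suc d /2⌋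
  2s≤1+d = ⌊n/2⌋+⌊n/2⌋≤n (suc d)
  open Greedy G (suc d) regular

  nonbipartite : ¬ IsBipartite G → + γᵗgr G / 1 ≥ (+ suc n + + suc s - + 2) / suc d
  nonbipartite nonbip = e≤d*γ⇒γ≥e/d d (suc n Nat.+ s ∸ 1) (γᵗgr G) (+ suc n + + suc s - + 2)
    (nonbipartite-numerator (suc n) s (s≤s z≤n))
    (nonbipartite-bound connected {s} 2s≤1+d zero nonbip)

  bipartite : IsBipartite G → + γᵗgr G / 1 ≥ (+ suc n + + 2 * + suc s - + 4) / suc d
  -- A `with` would normalise γᵗgr G in the goal, which does not terminate in practice.
  bipartite bip@(A , _) = e≤d*γ⇒γ≥e/d d
    ((∣ A ∣ Nat.+ s ∸ 1) Nat.+ (∣ ∁ A ∣ Nat.+ s ∸ 1)) (γᵗgr G) (+ suc n + + 2 * + suc s - + 4)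
    (trans (cong (λ m → + m + + 2 * + suc s - + 4) (sym (∣p∣+∣∁p∣≡n A)))
      (bipartite-numerator ∣ A ∣ ∣ ∁ A ∣ s (proj₁ bounds) (proj₁ (proj₂ bounds))))
    (proj₂ (proj₂ bounds))
    where bounds = bipartite-bound connected {s} 2s≤1+d zero ≇ bip
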